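{- For every nonnegative integer $n$, $$\sum_{k=0}^{\infty}(-1)^k(4k+1)\,\frac{(-n)_k\,(-4n-\tfrac32)_k\,(\tfrac12)_k}{k!\,(n+\tfrac32)_k\,(4n+3)_k}=\left(\frac{2^8}{5^5}\right)^n\frac{(\tfrac54)_n(\tfrac34)_n(\tfrac32)_n^2}{(\tfrac65)_n(\tfrac75)_n(\tfrac35)_n(\tfrac45)_n}.$$ (The sum is finite, since $(-n)_k=0$ for $k>n$.)
   Context: $(a)_j=\Gamma(a+j)/\Gamma(a)=a(a+1)\cdots(a+j-1)$ denotes the rising factorial (Pochhammer symbol), with $(a)_0=1$. -}

module Defs where

open import Algebra.Definitions.RawSemiring using ()
open import Data.Integer.Base using (+_)
open import Data.Nat.Base as ℕ using (ℕ; zero; suc; _!)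
open import Data.Nat.Properties using (_!≢0)
open import Data.Rational.Base
open import Data.Rational.Properties
  using (normalize-nonNeg; normalize-pos; pos+nonNeg⇒pos; nonNeg+pos⇒pos; nonNeg*nonNeg⇒nonNeg; pos*pos⇒pos; pos⇒nonZero)

open Algebra.Definitions.RawSemiring +-*-rawSemiring public using (_^_)

fromℕ : ℕ → ℚ
fromℕ n = + n / 1

-- poch a j = a (a + 1) ⋯ (a + j - 1); unlike the quotient Γ(a + j) / Γ(a),
-- the product also makes sense when a is a nonpositive integer.
poch : ℚ → ℕ → ℚ
poch a zero    = 1ℚ
poch a (suc j) = poch a j * (a + fromℕ j)

-- ∑[ k ≤ m ] f k = f 0 + f 1 + ⋯ + f m, both ends included.
∑≤ : ℕ → (ℕ → ℚ) → ℚ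
∑≤ zero    f = f 0
∑≤ (suc m) f = ∑≤ m f + f (suc m)

infix 5 ∑≤
syntax ∑≤ m (λ k → x) = ∑[ k ≤ m ] x

fromℕ-nonNeg : ∀ n → NonNegative (fromℕ n)
fromℕ-nonNeg n = normalize-nonNeg n 1

fromℕ-pos : ∀ n .{{_ : ℕ.NonZero n}} → Positive (fromℕ n)
fromℕ-pos n = normalize-pos n 1

fromℕ+-pos : ∀ n q .{{_ : Positive q}} → Positive (fromℕ n + q)
fromℕ+-pos n q = nonNeg+pos⇒pos (fromℕ n) {{fromℕ-nonNeg n}} q

poch-pos : ∀ a j .{{_ : Positive a}} → Positive (poch a j)
poch-pos a zero    = _
poch-pos a (suc j) =
  pos*pos⇒pos (poch a j) {{poch-pos a j}} (a + fromℕ j)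
    {{pos+nonNeg⇒pos a (fromℕ j) {{fromℕ-nonNeg j}}}}

*-pos : ∀ p q → Positive p → Positive q → Positive (p * q)
*-pos p q p>0 q>0 = pos*pos⇒pos p {{p>0}} q {{q>0}}

termDenominator : ℕ → ℕ → ℚ
termDenominator n k =
  fromℕ (k !)
  * poch (fromℕ n + + 3 / 2) k
  * poch (fromℕ 4 * fromℕ n + fromℕ 3) k

termDenominator-pos : ∀ n k → Positive (termDenominator n k)
termDenominator-pos n k =
  *-pos (fromℕ (k !) * poch (fromℕ n + + 3 / 2) k)
        (poch (fromℕ 4 * fromℕ n + fromℕ 3) k)
    (*-pos (fromℕ (k !)) (poch (fromℕ n + + 3 / 2) k)
      (fromℕ-pos (k !) {{k !≢0}})
      (poch-pos (fromℕ n + + 3 / 2) k {{fromℕ+-pos n (+ 3 / 2)}}))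
    (poch-pos (fromℕ 4 * fromℕ n + fromℕ 3) k {{4n+3-pos}})
  where
  4n-nonNeg : ∀ m → NonNegative (fromℕ 4 * fromℕ m)
  4n-nonNeg m = nonNeg*nonNeg⇒nonNeg (fromℕ 4) (fromℕ m) {{fromℕ-nonNeg m}}

  4n+3-pos : Positive (fromℕ 4 * fromℕ n + fromℕ 3)
  4n+3-pos = nonNeg+pos⇒pos (fromℕ 4 * fromℕ n) {{4n-nonNeg n}} (fromℕ 3)

term : ℕ → ℕ → ℚ
term n k =
  (- 1ℚ) ^ k * (fromℕ 4 * fromℕ k + 1ℚ)
  * ((poch (- fromℕ n) k
      * poch (- (fromℕ 4 * fromℕ n) - + 3 / 2) k
      * poch (+ 1 / 2) k)
     ÷ termDenominator n k)
  where instance _ = pos⇒nonZero (termDenominator n k) {{termDenominator-pos n k}}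

closedFormDenominator : ℕ → ℚ
closedFormDenominator n =
  poch (+ 6 / 5) n * poch (+ 7 / 5) n * poch (+ 3 / 5) n * poch (+ 4 / 5) n

closedFormDenominator-pos : ∀ n → Positive (closedFormDenominator n)
closedFormDenominator-pos n =
  *-pos (poch (+ 6 / 5) n * poch (+ 7 / 5) n * poch (+ 3 / 5) n) (poch (+ 4 / 5) n)
    (*-pos (poch (+ 6 / 5) n * poch (+ 7 / 5) n) (poch (+ 3 / 5) n)
      (*-pos (poch (+ 6 / 5) n) (poch (+ 7 / 5) n)
        (poch-pos (+ 6 / 5) n)
        (poch-pos (+ 7 / 5) n))
      (poch-pos (+ 3 / 5) n))
    (poch-pos (+ 4 / 5) n)

closedForm : ℕ → ℚ
closedForm n =
  (+ (2 ℕ.^ 8) / (5 ℕ.^ 5)) ^ n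
  * ((poch (+ 5 / 4) n * poch (+ 3 / 4) n * poch (+ 3 / 2) n ^ 2)
     ÷ closedFormDenominator n)
  where instance _ = pos⇒nonZero (closedFormDenominator n) {{closedFormDenominator-pos n}}

{-# OPTIONS --safe #-}

-- The sum is a terminating very-well-poised ₄F₃(-1) with parameters 1/2, -n and c = -4n - 3/2.
-- Freeing c from n and writing S(n) for the sum and e = 3/2 - c, the combination
-- (n + 1) ((e + n) S(n + 1) - (n + 3/2) S(n)) telescopes to 0, hence S(n) (e)_n = (3/2)_n.
-- Setting e = 4n + 3 leaves an identity between products, proved by induction on n.
module Submission where

open import Defs
open import Data.Integer.Base using (+_)
import Data.Integer.Base as ℤ
import Data.Integer.Properties as ℤ
open import Data.Nat.Base as ℕ using (ℕ; zero; suc; _<_; _!)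
import Data.Nat.Properties as ℕ
open import Data.Product.Base using (_×_; _,_)
open import Data.Rational.Base hiding (_<_)
open import Data.Rational.Properties
open import Data.Rational.Solver using (module +-*-Solver)
import Data.Rational.Unnormalised.Base as ℚᵘ
import Data.Rational.Unnormalised.Properties as ℚᵘ
open import Data.Sum.Base using (inj₁; inj₂)
open import Relation.Binary.PropositionalEquality
open import Algebra.Properties.Group +-0-group using (x∙y⁻¹≈ε⇒x≈y)
open +-*-Solver

-- Naturals inside `ℚ`, and fractions compared by cross-multiplication.

-- `+ n / 1` is reduced by a gcd, which is stuck for a variable `n`. Unnormalised fractions are
-- equal by cross-multiplication, so there only integer arithmetic remains.
fromℕ-suc : ∀ n → fromℕ (suc n) ≡ 1ℚ + fromℕ n
fromℕ-suc n = toℚᵘ-injective (begin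
  toℚᵘ (fromℕ (suc n))             ≈⟨ toℚᵘ-fromℚᵘ (ℚᵘ.mkℚᵘ (+ suc n) 0) ⟩
  ℚᵘ.mkℚᵘ (+ suc n) 0              ≈⟨ ℚᵘ.*≡* (cong (λ i → (+ 1 ℤ.+ i) ℤ.* + 1) (sym (ℤ.*-identityʳ (+ n)))) ⟩
  ℚᵘ.1ℚᵘ ℚᵘ.+ ℚᵘ.mkℚᵘ (+ n) 0      ≈⟨ ℚᵘ.+-congʳ ℚᵘ.1ℚᵘ (toℚᵘ-fromℚᵘ (ℚᵘ.mkℚᵘ (+ n) 0)) ⟨
  ℚᵘ.1ℚᵘ ℚᵘ.+ toℚᵘ (fromℕ n)       ≈⟨ toℚᵘ-homo-+ 1ℚ (fromℕ n) ⟨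
  toℚᵘ (1ℚ + fromℕ n)              ∎)
  where open ℚᵘ.≃-Reasoning

open ≡-Reasoning

fromℕ-+ : ∀ m n → fromℕ (m ℕ.+ n) ≡ fromℕ m + fromℕ n
fromℕ-+ zero    n = sym (+-identityˡ (fromℕ n))
fromℕ-+ (suc m) n = begin
  fromℕ (suc (m ℕ.+ n))      ≡⟨ fromℕ-suc (m ℕ.+ n) ⟩
  1ℚ + fromℕ (m ℕ.+ n)       ≡⟨ cong (λ z → 1ℚ + z) (fromℕ-+ m n) ⟩
  1ℚ + (fromℕ m + fromℕ n)   ≡⟨ +-assoc 1ℚ (fromℕ m) (fromℕ n) ⟨
  1ℚ + fromℕ m + fromℕ n     ≡⟨ cong (_+ fromℕ n) (fromℕ-suc m) ⟨
  fromℕ (suc m) + fromℕ n    ∎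

fromℕ-* : ∀ m n → fromℕ (m ℕ.* n) ≡ fromℕ m * fromℕ n
fromℕ-* zero    n = sym (*-zeroˡ (fromℕ n))
fromℕ-* (suc m) n = begin
  fromℕ (n ℕ.+ m ℕ.* n)              ≡⟨ fromℕ-+ n (m ℕ.* n) ⟩
  fromℕ n + fromℕ (m ℕ.* n)          ≡⟨ cong (λ z → fromℕ n + z) (fromℕ-* m n) ⟩
  fromℕ n + fromℕ m * fromℕ n        ≡⟨ lemma (fromℕ n) (fromℕ m) ⟩
  (1ℚ + fromℕ m) * fromℕ n           ≡⟨ cong (_* fromℕ n) (fromℕ-suc m) ⟨
  fromℕ (suc m) * fromℕ n            ∎
  where
  lemma : ∀ p q → p + q * p ≡ (1ℚ + q) * p
  lemma = solve 2 (λ p q → p :+ q :* p := (con 1ℚ :+ q) :* p) refl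

*-cancelˡ-pos : ∀ r .{{_ : Positive r}} {p q} → r * p ≡ r * q → p ≡ q
*-cancelˡ-pos r eq = ≤-antisym
  (*-cancelˡ-≤-pos r (≤-reflexive eq))
  (*-cancelˡ-≤-pos r (≤-reflexive (sym eq)))

÷-*-cancel : ∀ p q .{{_ : NonZero q}} → (p ÷ q) * q ≡ p
÷-*-cancel p q = begin
  p * (1/ q) * q     ≡⟨ *-assoc p (1/ q) q ⟩
  p * ((1/ q) * q)   ≡⟨ cong (p *_) (*-inverseˡ q) ⟩
  p * 1ℚ             ≡⟨ *-identityʳ p ⟩
  p                  ∎

-- Multiplying by `d * d′` clears both denominators. The fractions enter only through `q * d ≡ p`,
-- so a relation between quotients turns into a polynomial identity and no reciprocal reaches the
-- ring solver.
fraction-cross : ∀ {q d p q′ d′ p′} .{{_ : Positive d}} .{{_ : Positive d′}} →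
  q * d ≡ p → q′ * d′ ≡ p′ → ∀ a b → a * p * d′ ≡ b * p′ * d → a * q ≡ b * q′
fraction-cross {q} {d} {p} {q′} {d′} {p′} qd≡p q′d′≡p′ a b eq =
  *-cancelˡ-pos d (*-cancelˡ-pos d′ (begin
    d′ * (d * (a * q))      ≡⟨ arrange d′ d a q ⟩
    a * (q * d) * d′        ≡⟨ cong (λ z → a * z * d′) qd≡p ⟩
    a * p * d′              ≡⟨ eq ⟩
    b * p′ * d              ≡⟨ cong (λ z → b * z * d) q′d′≡p′ ⟨
    b * (q′ * d′) * d       ≡⟨ arrange′ d′ d b q′ ⟩
    d′ * (d * (b * q′))     ∎))
  where
  arrange : ∀ d′ d a q → d′ * (d * (a * q)) ≡ a * (q * d) * d′
  arrange = solve 4 (λ d′ d a q → d′ :* (d :* (a :* q)) := a :* (q :* d) :* d′) refl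

  arrange′ : ∀ d′ d b q → b * (q * d′) * d ≡ d′ * (d * (b * q))
  arrange′ = solve 4 (λ d′ d b q → b :* (q :* d′) :* d := d′ :* (d :* (b :* q))) refl

-- Rising factorials: shifting the base, vanishing at nonpositive integers.

-- Both sides are `a (a + 1) ⋯ (a + k)`, with the first or the last factor split off.
poch-shift : ∀ a k → a * poch (1ℚ + a) k ≡ poch a k * (a + fromℕ k)
poch-shift a zero    = solve 1 (λ a → a :* con 1ℚ := con 1ℚ :* (a :+ con 0ℚ)) refl a
poch-shift a (suc k) = begin
  a * (poch (1ℚ + a) k * (1ℚ + a + fromℕ k))
    ≡⟨ *-assoc a (poch (1ℚ + a) k) (1ℚ + a + fromℕ k) ⟨
  a * poch (1ℚ + a) k * (1ℚ + a + fromℕ k)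
    ≡⟨ cong₂ _*_ (poch-shift a k) (shuffle a (fromℕ k)) ⟩
  poch a k * (a + fromℕ k) * (a + (1ℚ + fromℕ k))
    ≡⟨ cong (λ z → poch a (suc k) * (a + z)) (fromℕ-suc k) ⟨
  poch a (suc k) * (a + fromℕ (suc k))
    ∎
  where
  shuffle : ∀ a k → 1ℚ + a + k ≡ a + (1ℚ + k)
  shuffle = solve 2 (λ a k → con 1ℚ :+ a :+ k := a :+ (con 1ℚ :+ k)) refl

-- The product contains the factor `- fromℕ n + fromℕ n`; the induction strips later factors until
-- this one is last.
poch-vanishes : ∀ n k → n < k → poch (- fromℕ n) k ≡ 0ℚ
poch-vanishes n (suc k) (ℕ.s≤s n≤k) with ℕ.m≤n⇒m<n∨m≡n n≤k
... | inj₁ n<k = begin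
  poch (- fromℕ n) k * (- fromℕ n + fromℕ k)   ≡⟨ cong (_* (- fromℕ n + fromℕ k)) (poch-vanishes n k n<k) ⟩
  0ℚ * (- fromℕ n + fromℕ k)                   ≡⟨ *-zeroˡ (- fromℕ n + fromℕ k) ⟩
  0ℚ                                           ∎
... | inj₂ refl = begin
  poch (- fromℕ n) n * (- fromℕ n + fromℕ n)   ≡⟨ cong (poch (- fromℕ n) n *_) (+-inverseˡ (fromℕ n)) ⟩
  poch (- fromℕ n) n * 0ℚ                      ≡⟨ *-zeroʳ (poch (- fromℕ n) n) ⟩
  0ℚ                                           ∎

-- The well-poised summand and its two-term relations in `k` and in `x`.

-- x stands for the upper index n; only (-x)_k needs it to be a natural number, for termination.
module WellPoised (c e : ℚ) (e>0 : Positive e) (c≡3/2-e : c ≡ + 3 / 2 - e) where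

  numerator : ℚ → ℕ → ℚ
  numerator x k = poch (- x) k * poch c k * poch (+ 1 / 2) k

  denominator : ℚ → ℕ → ℚ
  denominator x k = fromℕ (k !) * poch (x + + 3 / 2) k * poch e k

  denominator-pos : ∀ x → Positive (x + + 3 / 2) → ∀ k → Positive (denominator x k)
  denominator-pos x x>0 k =
    *-pos (fromℕ (k !) * poch (x + + 3 / 2) k) (poch e k)
      (*-pos (fromℕ (k !)) (poch (x + + 3 / 2) k)
        (fromℕ-pos (k !) {{k ℕ.!≢0}}) (poch-pos (x + + 3 / 2) k {{x>0}}))
      (poch-pos e k {{e>0}})

  -- The positivity proof is irrelevant, so the value depends on `x` and `k` alone.
  quotient : ∀ x → .(Positive (x + + 3 / 2)) → ℕ → ℚ
  quotient x x>0 k = numerator x k ÷ denominator x k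
    where instance _ = pos⇒nonZero (denominator x k) {{denominator-pos x x>0 k}}

  summand : ∀ x → .(Positive (x + + 3 / 2)) → ℕ → ℚ
  summand x x>0 k = (- 1ℚ) ^ k * (fromℕ 4 * fromℕ k + 1ℚ) * quotient x x>0 k

  quotient-spec : ∀ x .(x>0 : Positive (x + + 3 / 2)) k →
    quotient x x>0 k * denominator x k ≡ numerator x k
  quotient-spec x x>0 k = ÷-*-cancel (numerator x k) (denominator x k)
    {{pos⇒nonZero (denominator x k) {{denominator-pos x x>0 k}}}}

  quotient-cross : ∀ x .(x>0 : Positive (x + + 3 / 2)) k
    x′ .(x′>0 : Positive (x′ + + 3 / 2)) k′ a b →
    a * numerator x k * denominator x′ k′ ≡ b * numerator x′ k′ * denominator x k →
    a * quotient x x>0 k ≡ b * quotient x′ x′>0 k′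
  quotient-cross x x>0 k x′ x′>0 k′ =
    fraction-cross {{denominator-pos x x>0 k}} {{denominator-pos x′ x′>0 k′}}
      (quotient-spec x x>0 k) (quotient-spec x′ x′>0 k′)

  -- The term ratio in `k` with denominators cleared: every rising factorial gains its last factor
  -- by definition, and the factorial gains `suc k`.
  quotient-suc : ∀ x .(x>0 : Positive (x + + 3 / 2)) k →
    fromℕ (suc k) * (x + + 3 / 2 + fromℕ k) * (e + fromℕ k) * quotient x x>0 (suc k)
    ≡ (- x + fromℕ k) * (c + fromℕ k) * (+ 1 / 2 + fromℕ k) * quotient x x>0 k
  quotient-suc x x>0 k =
    quotient-cross x x>0 (suc k) x x>0 k (fromℕ (suc k) * b * f) (α * γ * η)
      (begin
        fromℕ (suc k) * b * f * (P * α * (C * γ) * (H * η)) * (F * B * E)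
          ≡⟨ arrange (fromℕ (suc k)) b f P α C γ H η F B E ⟩
        α * γ * η * (P * C * H) * (fromℕ (suc k) * F * (B * b) * (E * f))
          ≡⟨ cong (λ z → α * γ * η * (P * C * H) * (z * (B * b) * (E * f)))
               (fromℕ-* (suc k) (k !)) ⟨
        α * γ * η * (P * C * H) * (fromℕ (suc k !) * (B * b) * (E * f))
          ∎)
    where
    b = x + + 3 / 2 + fromℕ k
    f = e + fromℕ k
    α = - x + fromℕ k
    γ = c + fromℕ k
    η = + 1 / 2 + fromℕ k
    P = poch (- x) k
    C = poch c k
    H = poch (+ 1 / 2) k
    F = fromℕ (k !)
    B = poch (x + + 3 / 2) k
    E = poch e k

    arrange : ∀ s b f P α C γ H η F B E →
      s * b * f * (P * α * (C * γ) * (H * η)) * (F * B * E)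
      ≡ α * γ * η * (P * C * H) * (s * F * (B * b) * (E * f))
    arrange = solve 12 (λ s b f P α C γ H η F B E →
      s :* b :* f :* (P :* α :* (C :* γ) :* (H :* η)) :* (F :* B :* E)
      := α :* γ :* η :* (P :* C :* H) :* (s :* F :* (B :* b) :* (E :* f))) refl

  -- Only `(-x)_k` and `(x + 3/2)_k` depend on `x`. `poch-shift` at `-(1 + x)` and at `x + 3/2`
  -- relates each to its counterpart at `1 + x`.
  quotient-shift : ∀ x .(x>0 : Positive (x + + 3 / 2)) .(1+x>0 : Positive (1ℚ + x + + 3 / 2)) k →
    (1ℚ + x) * (x + + 3 / 2) * quotient x x>0 k
    ≡ (1ℚ + x - fromℕ k) * (x + + 3 / 2 + fromℕ k) * quotient (1ℚ + x) 1+x>0 k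
  quotient-shift x x>0 1+x>0 k =
    quotient-cross x x>0 k (1ℚ + x) 1+x>0 k
      ((1ℚ + x) * b) ((1ℚ + x - fromℕ k) * (b + fromℕ k))
      (begin
        (1ℚ + x) * b * (P * C * H) * (F * B′ * E)
          ≡⟨ arrange x b P C H F B′ E ⟩
        - (- (1ℚ + x) * P) * (b * B′) * (C * H * F * E)
          ≡⟨ cong₂ (λ s t → - s * t * (C * H * F * E)) P-shift B-shift ⟩
        - (P′ * (- (1ℚ + x) + fromℕ k)) * (B * (b + fromℕ k)) * (C * H * F * E)
          ≡⟨ arrange′ x b (fromℕ k) P′ C H F B E ⟩
        (1ℚ + x - fromℕ k) * (b + fromℕ k) * (P′ * C * H) * (F * B * E)
          ∎)
    where
    b = x + + 3 / 2
    P = poch (- x) k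
    P′ = poch (- (1ℚ + x)) k
    C = poch c k
    H = poch (+ 1 / 2) k
    F = fromℕ (k !)
    B = poch b k
    B′ = poch (1ℚ + x + + 3 / 2) k
    E = poch e k

    P-shift : - (1ℚ + x) * P ≡ P′ * (- (1ℚ + x) + fromℕ k)
    P-shift = begin
      - (1ℚ + x) * poch (- x) k
        ≡⟨ cong (λ z → - (1ℚ + x) * poch z k)
             (solve 1 (λ x → :- x := con 1ℚ :+ :- (con 1ℚ :+ x)) refl x) ⟩
      - (1ℚ + x) * poch (1ℚ + - (1ℚ + x)) k
        ≡⟨ poch-shift (- (1ℚ + x)) k ⟩
      P′ * (- (1ℚ + x) + fromℕ k)
        ∎

    B-shift : b * B′ ≡ B * (b + fromℕ k)
    B-shift = begin
      b * poch (1ℚ + x + + 3 / 2) k     ≡⟨ cong (λ z → b * poch z k) (+-assoc 1ℚ x (+ 3 / 2)) ⟩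
      b * poch (1ℚ + b) k               ≡⟨ poch-shift b k ⟩
      B * (b + fromℕ k)                 ∎

    arrange : ∀ x b P C H F B′ E →
      (1ℚ + x) * b * (P * C * H) * (F * B′ * E)
      ≡ - (- (1ℚ + x) * P) * (b * B′) * (C * H * F * E)
    arrange = solve 8 (λ x b P C H F B′ E →
      (con 1ℚ :+ x) :* b :* (P :* C :* H) :* (F :* B′ :* E)
      := :- (:- (con 1ℚ :+ x) :* P) :* (b :* B′) :* (C :* H :* F :* E)) refl

    arrange′ : ∀ x b k P′ C H F B E →
      - (P′ * (- (1ℚ + x) + k)) * (B * (b + k)) * (C * H * F * E)
      ≡ (1ℚ + x - k) * (b + k) * (P′ * C * H) * (F * B * E)
    arrange′ = solve 9 (λ x b k P′ C H F B E →
      :- (P′ :* (:- (con 1ℚ :+ x) :+ k)) :* (B :* (b :+ k)) :* (C :* H :* F :* E)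
      := (con 1ℚ :+ x :- k) :* (b :+ k) :* (P′ :* C :* H) :* (F :* B :* E)) refl

  -- Telescoping between the upper indices `x` and `1 + x`.

  partialSum : ∀ x → .(Positive (x + + 3 / 2)) → ℕ → ℚ
  partialSum x x>0 m = ∑≤ m (summand x x>0)

  module _ (x : ℚ) .(x>0 : Positive (x + + 3 / 2)) .(1+x>0 : Positive (1ℚ + x + + 3 / 2)) where

    -- The factors `1 + x` and `x + 3/2` are those that `quotient-shift` needs to express both
    -- summands through the quotient at `1 + x`. As `e - 3/2 = -c`, the coefficients then differ by
    -- `k (k + 1/2) - c (1 + x)`.
    summand-difference : ∀ k →
      (1ℚ + x) * ((e + x) * summand (1ℚ + x) 1+x>0 k - (x + + 3 / 2) * summand x x>0 k)
      ≡ (- 1ℚ) ^ k * (fromℕ 4 * fromℕ k + 1ℚ)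
        * (fromℕ k * (fromℕ k + + 1 / 2) - c * (1ℚ + x))
        * quotient (1ℚ + x) 1+x>0 k
    summand-difference k = begin
      (1ℚ + x) * ((e + x) * (s * w * q′) - b * (s * w * q))
        ≡⟨ arrange x b s w q q′ e ⟩
      s * w * ((1ℚ + x) * (e + x) * q′ - (1ℚ + x) * b * q)
        ≡⟨ cong (λ z → s * w * ((1ℚ + x) * (e + x) * q′ - z)) (quotient-shift x x>0 1+x>0 k) ⟩
      s * w * ((1ℚ + x) * (e + x) * q′ - (1ℚ + x - fromℕ k) * (b + fromℕ k) * q′)
        ≡⟨ simplify x s w q′ (fromℕ k) e c≡3/2-e ⟩
      s * w * (fromℕ k * (fromℕ k + + 1 / 2) - c * (1ℚ + x)) * q′
        ∎
      where
      b = x + + 3 / 2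
      s = (- 1ℚ) ^ k
      w = fromℕ 4 * fromℕ k + 1ℚ
      q = quotient x x>0 k
      q′ = quotient (1ℚ + x) 1+x>0 k

      arrange : ∀ x b s w q q′ e →
        (1ℚ + x) * ((e + x) * (s * w * q′) - b * (s * w * q))
        ≡ s * w * ((1ℚ + x) * (e + x) * q′ - (1ℚ + x) * b * q)
      arrange = solve 7 (λ x b s w q q′ e →
        (con 1ℚ :+ x) :* ((e :+ x) :* (s :* w :* q′) :- b :* (s :* w :* q))
        := s :* w :* ((con 1ℚ :+ x) :* (e :+ x) :* q′ :- (con 1ℚ :+ x) :* b :* q)) refl

      -- Matching on the equation replaces `c` by `3/2 - e`, which leaves a polynomial identity for
      -- the solver.
      simplify : ∀ x s w q′ k e {c} → c ≡ + 3 / 2 - e →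
        s * w * ((1ℚ + x) * (e + x) * q′ - (1ℚ + x - k) * (x + + 3 / 2 + k) * q′)
        ≡ s * w * (k * (k + + 1 / 2) - c * (1ℚ + x)) * q′
      simplify x s w q′ k e refl = solve 6 (λ x s w q′ k e →
        s :* w :* ((con 1ℚ :+ x) :* (e :+ x) :* q′
                   :- (con 1ℚ :+ x :- k) :* (x :+ con (+ 3 / 2) :+ k) :* q′)
        := s :* w :* (k :* (k :+ con (+ 1 / 2)) :- (con (+ 3 / 2) :- e) :* (con 1ℚ :+ x)) :* q′)
        refl x s w q′ k e

    -- The right-hand side is Gosper's antidifference of the summand difference; it vanishes at
    -- m = x + 1.
    partialSum-difference : ∀ m →
      (1ℚ + x) * ((e + x) * partialSum (1ℚ + x) 1+x>0 m - (x + + 3 / 2) * partialSum x x>0 m)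
      ≡ - (fromℕ 2 * (1ℚ + x - fromℕ m) * (+ 1 / 2 + fromℕ m) * (c + fromℕ m))
        * ((- 1ℚ) ^ m * quotient (1ℚ + x) 1+x>0 m)
    -- At `m = 0` both sides are `- c (1 + x)` times the initial quotient.
    partialSum-difference zero = trans (summand-difference 0)
      (solve 3 (λ x c q →
        con 1ℚ :* con (fromℕ 4 * fromℕ 0 + 1ℚ)
          :* (con (fromℕ 0) :* (con (fromℕ 0 + + 1 / 2)) :- c :* (con 1ℚ :+ x)) :* q
        := :- (con (fromℕ 2) :* (con 1ℚ :+ x :- con (fromℕ 0))
               :* con (+ 1 / 2 + fromℕ 0) :* (c :+ con (fromℕ 0)))
          :* (con 1ℚ :* q)) refl x c (quotient (1ℚ + x) 1+x>0 0))
    partialSum-difference (suc m) = begin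
      (1ℚ + x) * ((e + x) * (S′ + t′) - b * (S + t))
        ≡⟨ arrange x b e S S′ t t′ ⟩
      (1ℚ + x) * ((e + x) * S′ - b * S) + (1ℚ + x) * ((e + x) * t′ - b * t)
        ≡⟨ cong₂ _+_ (partialSum-difference m) (summand-difference (suc m)) ⟩
      - (fromℕ 2 * (1ℚ + x - μ) * (+ 1 / 2 + μ) * (c + μ)) * (s * q) + r
        ≡⟨ cong (_+ r) (arrange′ x μ c s q) ⟩
      fromℕ 2 * s * ((- (1ℚ + x) + μ) * (c + μ) * (+ 1 / 2 + μ) * q) + r
        -- The antidifference at `m` contains exactly the numerator factors of the term ratio at
        -- `1 + x`, so it becomes a multiple of `q′`, like `r`; comparing polynomial coefficients
        -- finishes the step.
        ≡⟨ cong (λ z → fromℕ 2 * s * z + r) (quotient-suc (1ℚ + x) 1+x>0 m) ⟨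
      fromℕ 2 * s * (fromℕ (suc m) * (1ℚ + x + + 3 / 2 + μ) * (e + μ) * q′) + r
        ≡⟨ simplify x μ s q′ e (fromℕ-suc m) c≡3/2-e ⟩
      - (fromℕ 2 * (1ℚ + x - fromℕ (suc m)) * (+ 1 / 2 + fromℕ (suc m)) * (c + fromℕ (suc m)))
        * (- 1ℚ * s * q′)
        ∎
      where
      b = x + + 3 / 2
      μ = fromℕ m
      s = (- 1ℚ) ^ m
      q = quotient (1ℚ + x) 1+x>0 m
      q′ = quotient (1ℚ + x) 1+x>0 (suc m)
      S = partialSum x x>0 m
      S′ = partialSum (1ℚ + x) 1+x>0 m
      t = summand x x>0 (suc m)
      t′ = summand (1ℚ + x) 1+x>0 (suc m)
      r = - 1ℚ * s * (fromℕ 4 * fromℕ (suc m) + 1ℚ)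
          * (fromℕ (suc m) * (fromℕ (suc m) + + 1 / 2) - c * (1ℚ + x)) * q′

      arrange : ∀ x b e S S′ t t′ →
        (1ℚ + x) * ((e + x) * (S′ + t′) - b * (S + t))
        ≡ (1ℚ + x) * ((e + x) * S′ - b * S) + (1ℚ + x) * ((e + x) * t′ - b * t)
      arrange = solve 7 (λ x b e S S′ t t′ →
        (con 1ℚ :+ x) :* ((e :+ x) :* (S′ :+ t′) :- b :* (S :+ t))
        := (con 1ℚ :+ x) :* ((e :+ x) :* S′ :- b :* S)
           :+ (con 1ℚ :+ x) :* ((e :+ x) :* t′ :- b :* t)) refl

      arrange′ : ∀ x μ c s q →
        - (fromℕ 2 * (1ℚ + x - μ) * (+ 1 / 2 + μ) * (c + μ)) * (s * q)
        ≡ fromℕ 2 * s * ((- (1ℚ + x) + μ) * (c + μ) * (+ 1 / 2 + μ) * q)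
      arrange′ = solve 5 (λ x μ c s q →
        :- (con (fromℕ 2) :* (con 1ℚ :+ x :- μ) :* (con (+ 1 / 2) :+ μ) :* (c :+ μ)) :* (s :* q)
        := con (fromℕ 2) :* s
           :* ((:- (con 1ℚ :+ x) :+ μ) :* (c :+ μ) :* (con (+ 1 / 2) :+ μ) :* q)) refl

      simplify : ∀ x μ s q′ e {μ′ c} → μ′ ≡ 1ℚ + μ → c ≡ + 3 / 2 - e →
        fromℕ 2 * s * (μ′ * (1ℚ + x + + 3 / 2 + μ) * (e + μ) * q′)
          + - 1ℚ * s * (fromℕ 4 * μ′ + 1ℚ) * (μ′ * (μ′ + + 1 / 2) - c * (1ℚ + x)) * q′
        ≡ - (fromℕ 2 * (1ℚ + x - μ′) * (+ 1 / 2 + μ′) * (c + μ′)) * (- 1ℚ * s * q′)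
      simplify x μ s q′ e refl refl = solve 5 (λ x μ s q′ e →
        let μ′ = con 1ℚ :+ μ
            c = con (+ 3 / 2) :- e
        in
        con (fromℕ 2) :* s :* (μ′ :* (con 1ℚ :+ x :+ con (+ 3 / 2) :+ μ) :* (e :+ μ) :* q′)
          :+ con (- 1ℚ) :* s :* (con (fromℕ 4) :* μ′ :+ con 1ℚ)
             :* (μ′ :* (μ′ :+ con (+ 1 / 2)) :- c :* (con 1ℚ :+ x)) :* q′
        := :- (con (fromℕ 2) :* (con 1ℚ :+ x :- μ′) :* (con (+ 1 / 2) :+ μ′) :* (c :+ μ′))
           :* (con (- 1ℚ) :* s :* q′)) refl x μ s q′ e

  -- Termination, the recurrence in `n`, and the summation formula with `e` free.

  -- Used to pass between the upper indices `fromℕ (suc n)` and `1ℚ + fromℕ n`, which are equal only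
  -- propositionally; irrelevance identifies the positivity proofs.
  partialSum-cong : ∀ {x y} .{x>0 : Positive (x + + 3 / 2)} .{y>0 : Positive (y + + 3 / 2)} →
    x ≡ y → ∀ m → partialSum x x>0 m ≡ partialSum y y>0 m
  partialSum-cong refl m = refl

  summand-vanishes : ∀ n k → n < k → summand (fromℕ n) (fromℕ+-pos n (+ 3 / 2)) k ≡ 0ℚ
  summand-vanishes n k n<k = trans
    -- The division is unfolded into a product with the reciprocal, so that the zero factor can be
    -- substituted and annihilate the rest.
    (cong (λ z → (- 1ℚ) ^ k * (fromℕ 4 * fromℕ k + 1ℚ)
                 * (z * poch c k * poch (+ 1 / 2) k * (1/ denominator (fromℕ n) k)))
          (poch-vanishes n k n<k))
    (annihilate ((- 1ℚ) ^ k * (fromℕ 4 * fromℕ k + 1ℚ)) (poch c k) (poch (+ 1 / 2) k)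
      (1/ denominator (fromℕ n) k))
    where
    instance _ = pos⇒nonZero (denominator (fromℕ n) k)
                   {{denominator-pos (fromℕ n) (fromℕ+-pos n (+ 3 / 2)) k}}

    annihilate : ∀ s p q r → s * (0ℚ * p * q * r) ≡ 0ℚ
    annihilate = solve 4 (λ s p q r → s :* (con 0ℚ :* p :* q :* r) := con 0ℚ) refl

  -- Stopping at `n` loses nothing, by `summand-vanishes`.
  fullSum : ℕ → ℚ
  fullSum n = partialSum (fromℕ n) (fromℕ+-pos n (+ 3 / 2)) n

  -- Both sums are taken up to `suc n`, where the antidifference vanishes, and the positive factor
  -- `1ℚ + fromℕ n` is cancelled. For the upper index `n` this range has one surplus summand, which
  -- is zero.
  fullSum-suc : ∀ n → (e + fromℕ n) * fullSum (suc n) ≡ (fromℕ n + + 3 / 2) * fullSum n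
  fullSum-suc n = begin
    (e + x) * fullSum (suc n)
      ≡⟨ cong ((e + x) *_)
           (partialSum-cong {x>0 = fromℕ+-pos (suc n) (+ 3 / 2)} {1+x>0} (fromℕ-suc n) (suc n)) ⟩
    (e + x) * partialSum (1ℚ + x) 1+x>0 (suc n)
      ≡⟨ x∙y⁻¹≈ε⇒x≈y _ _ difference≡0 ⟩
    (x + + 3 / 2) * partialSum x x>0 (suc n)
      ≡⟨ cong (λ z → (x + + 3 / 2) * (fullSum n + z)) (summand-vanishes n (suc n) ℕ.≤-refl) ⟩
    (x + + 3 / 2) * (fullSum n + 0ℚ)
      ≡⟨ cong ((x + + 3 / 2) *_) (+-identityʳ (fullSum n)) ⟩
    (x + + 3 / 2) * fullSum n
      ∎
    where
    x = fromℕ n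

    x>0 : Positive (x + + 3 / 2)
    x>0 = fromℕ+-pos n (+ 3 / 2)

    1+x>0 : Positive (1ℚ + x + + 3 / 2)
    1+x>0 = subst (λ z → Positive (z + + 3 / 2)) (fromℕ-suc n) (fromℕ+-pos (suc n) (+ 3 / 2))

    difference : ℚ
    difference = (e + x) * partialSum (1ℚ + x) 1+x>0 (suc n)
                 - (x + + 3 / 2) * partialSum x x>0 (suc n)

    annihilate : ∀ {y z} → z ≡ y → ∀ h d q →
      - (fromℕ 2 * (y - z) * h * d) * q ≡ (1ℚ + x) * 0ℚ
    annihilate {y} refl h d q = solve 5 (λ x y h d q →
      :- (con (fromℕ 2) :* (y :- y) :* h :* d) :* q := (con 1ℚ :+ x) :* con 0ℚ) refl x y h d q

    difference≡0 : difference ≡ 0ℚ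
    difference≡0 = *-cancelˡ-pos (1ℚ + x) {{subst Positive (fromℕ-suc n) (fromℕ-pos (suc n))}}
      (trans (partialSum-difference x x>0 1+x>0 (suc n))
             (annihilate (fromℕ-suc n) (+ 1 / 2 + fromℕ (suc n)) (c + fromℕ (suc n))
               ((- 1ℚ) ^ suc n * quotient (1ℚ + x) 1+x>0 (suc n))))

  -- The case `a = 1/2` of the classical terminating evaluation `(1 + a)_n / (1 + a - c)_n` of the
  -- very-well-poised ₄F₃(-1), obtained by iterating `fullSum-suc` from the value 1 at `n = 0`.
  fullSum-closed : ∀ n → fullSum n * poch e n ≡ poch (+ 3 / 2) n
  fullSum-closed zero    = refl
  fullSum-closed (suc n) = begin
    fullSum (suc n) * (poch e n * (e + fromℕ n))
      ≡⟨ arrange (fullSum (suc n)) (poch e n) (e + fromℕ n) ⟩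
    (e + fromℕ n) * fullSum (suc n) * poch e n
      ≡⟨ cong (_* poch e n) (fullSum-suc n) ⟩
    (fromℕ n + + 3 / 2) * fullSum n * poch e n
      ≡⟨ arrange′ (fromℕ n) (fullSum n) (poch e n) ⟩
    fullSum n * poch e n * (+ 3 / 2 + fromℕ n)
      ≡⟨ cong (_* (+ 3 / 2 + fromℕ n)) (fullSum-closed n) ⟩
    poch (+ 3 / 2) n * (+ 3 / 2 + fromℕ n)
      ∎
    where
    arrange : ∀ s p q → s * (p * q) ≡ q * s * p
    arrange = solve 3 (λ s p q → s :* (p :* q) := q :* s :* p) refl

    arrange′ : ∀ x s p → (x + + 3 / 2) * s * p ≡ s * p * (+ 3 / 2 + x)
    arrange′ = solve 3 (λ x s p →
      (x :+ con (+ 3 / 2)) :* s :* p := s :* p :* (con (+ 3 / 2) :+ x)) refl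

-- The product identity that remains at `e = 4n + 3`.

poch-+ : ∀ a m n → poch a (m ℕ.+ n) ≡ poch a m * poch (a + fromℕ m) n
poch-+ a m zero    = trans (cong (poch a) (ℕ.+-identityʳ m)) (sym (*-identityʳ (poch a m)))
poch-+ a m (suc n) = begin
  poch a (m ℕ.+ suc n)
    ≡⟨ cong (poch a) (ℕ.+-suc m n) ⟩
  poch a (m ℕ.+ n) * (a + fromℕ (m ℕ.+ n))
    ≡⟨ cong₂ (λ p z → p * (a + z)) (poch-+ a m n) (fromℕ-+ m n) ⟩
  poch a m * poch (a + fromℕ m) n * (a + (fromℕ m + fromℕ n))
    ≡⟨ arrange (poch a m) (poch (a + fromℕ m) n) a (fromℕ m) (fromℕ n) ⟩
  poch a m * (poch (a + fromℕ m) n * (a + fromℕ m + fromℕ n))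
    ∎
  where
  arrange : ∀ p q a x y → p * q * (a + (x + y)) ≡ p * (q * (a + x + y))
  arrange = solve 5 (λ p q a x y → p :* q :* (a :+ (x :+ y)) := p :* (q :* (a :+ x :+ y))) refl

4n+3 : ℕ → ℚ
4n+3 n = fromℕ 4 * fromℕ n + fromℕ 3

4n+3-pos : ∀ n → Positive (4n+3 n)
4n+3-pos n = nonNeg+pos⇒pos (fromℕ 4 * fromℕ n)
  {{nonNeg*nonNeg⇒nonNeg (fromℕ 4) (fromℕ n) {{fromℕ-nonNeg n}}}} (fromℕ 3)

ratio : ℚ
ratio = + (2 ℕ.^ 8) / (5 ℕ.^ 5)

-- The two parametrisations of (4n+3)_{n+5} are  (4n+3)_n (5n+3)⋯(5n+7)  and  (4n+3)_4 (4n+7)_{n+1}.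
poch-4n+3-suc : ∀ n →
  poch (4n+3 n) 4 * poch (4n+3 (suc n)) (suc n)
  ≡ poch (4n+3 n) n * (4n+3 n + fromℕ n) * (4n+3 n + fromℕ (1 ℕ.+ n))
    * (4n+3 n + fromℕ (2 ℕ.+ n)) * (4n+3 n + fromℕ (3 ℕ.+ n)) * (4n+3 n + fromℕ (4 ℕ.+ n))
poch-4n+3-suc n = begin
  poch (4n+3 n) 4 * poch (4n+3 (suc n)) (suc n)
    ≡⟨ cong (λ z → poch (4n+3 n) 4 * poch z (suc n)) (advance (fromℕ n) (fromℕ-suc n)) ⟩
  poch (4n+3 n) 4 * poch (4n+3 n + fromℕ 4) (suc n)
    ≡⟨ poch-+ (4n+3 n) 4 (suc n) ⟨
  -- `4 ℕ.+ suc n` computes to five successors of `n`, and unfolding `poch` five times gives the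
  -- right-hand side.
  poch (4n+3 n) (4 ℕ.+ suc n)
    ∎
  where
  advance : ∀ x {y} → y ≡ 1ℚ + x → fromℕ 4 * y + fromℕ 3 ≡ fromℕ 4 * x + fromℕ 3 + fromℕ 4
  advance x refl = solve 1 (λ x →
    con (fromℕ 4) :* (con 1ℚ :+ x) :+ con (fromℕ 3)
    := con (fromℕ 4) :* x :+ con (fromℕ 3) :+ con (fromℕ 4)) refl x

-- What is left of the claim after one `(3/2)_n` is cancelled. Base and length of `(4n+3)_n` both
-- move with `n`, so the induction step is first multiplied by `(4n+3)_4`, which makes
-- `poch-4n+3-suc` applicable.
poch-product : ∀ n →
  ratio ^ n * (poch (+ 5 / 4) n * poch (+ 3 / 4) n * poch (+ 3 / 2) n) * poch (4n+3 n) n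
  ≡ closedFormDenominator n
poch-product zero    = refl
poch-product (suc n) = *-cancelˡ-pos (poch (4n+3 n) 4) {{poch-pos (4n+3 n) 4 {{4n+3-pos n}}}} (begin
  P * (ratio * R * (A * a * (B * b) * (C * c)) * E′)
    ≡⟨ arrange P ratio R A a B b C c E′ ⟩
  ratio * a * b * c * (R * (A * B * C)) * (P * E′)
    ≡⟨ cong (ratio * a * b * c * (R * (A * B * C)) *_) (poch-4n+3-suc n) ⟩
  ratio * a * b * c * (R * (A * B * C)) * (E * f₀ * f₁ * f₂ * f₃ * f₄)
    ≡⟨ arrange′ ratio R A a B b C c E f₀ f₁ f₂ f₃ f₄ ⟩
  R * (A * B * C) * E * (ratio * a * b * c * (f₀ * f₁ * f₂ * f₃ * f₄))
    ≡⟨ cong (_* (ratio * a * b * c * (f₀ * f₁ * f₂ * f₃ * f₄))) (poch-product n) ⟩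
  D₁ * D₂ * D₃ * D₄ * (ratio * a * b * c * (f₀ * f₁ * f₂ * f₃ * f₄))
    ≡⟨ cong (D₁ * D₂ * D₃ * D₄ *_)
         (factors (fromℕ n) (fromℕ-+ 1 n) (fromℕ-+ 2 n) (fromℕ-+ 3 n) (fromℕ-+ 4 n)) ⟩
  D₁ * D₂ * D₃ * D₄ * (P * (d₁ * d₂ * d₃ * d₄))
    ≡⟨ arrange″ P D₁ d₁ D₂ d₂ D₃ d₃ D₄ d₄ ⟩
  P * (D₁ * d₁ * (D₂ * d₂) * (D₃ * d₃) * (D₄ * d₄))
    ∎)
  where
  P = poch (4n+3 n) 4
  R = ratio ^ n
  A = poch (+ 5 / 4) n
  B = poch (+ 3 / 4) n
  C = poch (+ 3 / 2) n
  E = poch (4n+3 n) n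
  E′ = poch (4n+3 (suc n)) (suc n)
  D₁ = poch (+ 6 / 5) n
  D₂ = poch (+ 7 / 5) n
  D₃ = poch (+ 3 / 5) n
  D₄ = poch (+ 4 / 5) n
  a = + 5 / 4 + fromℕ n
  b = + 3 / 4 + fromℕ n
  c = + 3 / 2 + fromℕ n
  d₁ = + 6 / 5 + fromℕ n
  d₂ = + 7 / 5 + fromℕ n
  d₃ = + 3 / 5 + fromℕ n
  d₄ = + 4 / 5 + fromℕ n
  f₀ = 4n+3 n + fromℕ n
  f₁ = 4n+3 n + fromℕ (1 ℕ.+ n)
  f₂ = 4n+3 n + fromℕ (2 ℕ.+ n)
  f₃ = 4n+3 n + fromℕ (3 ℕ.+ n)
  f₄ = 4n+3 n + fromℕ (4 ℕ.+ n)

  arrange : ∀ P r R A a B b C c E →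
    P * (r * R * (A * a * (B * b) * (C * c)) * E) ≡ r * a * b * c * (R * (A * B * C)) * (P * E)
  arrange = solve 10 (λ P r R A a B b C c E →
    P :* (r :* R :* (A :* a :* (B :* b) :* (C :* c)) :* E)
    := r :* a :* b :* c :* (R :* (A :* B :* C)) :* (P :* E)) refl

  arrange′ : ∀ r R A a B b C c E f₀ f₁ f₂ f₃ f₄ →
    r * a * b * c * (R * (A * B * C)) * (E * f₀ * f₁ * f₂ * f₃ * f₄)
    ≡ R * (A * B * C) * E * (r * a * b * c * (f₀ * f₁ * f₂ * f₃ * f₄))
  arrange′ = solve 14 (λ r R A a B b C c E f₀ f₁ f₂ f₃ f₄ →
    r :* a :* b :* c :* (R :* (A :* B :* C)) :* (E :* f₀ :* f₁ :* f₂ :* f₃ :* f₄)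
    := R :* (A :* B :* C) :* E :* (r :* a :* b :* c :* (f₀ :* f₁ :* f₂ :* f₃ :* f₄))) refl

  arrange″ : ∀ P D₁ d₁ D₂ d₂ D₃ d₃ D₄ d₄ →
    D₁ * D₂ * D₃ * D₄ * (P * (d₁ * d₂ * d₃ * d₄))
    ≡ P * (D₁ * d₁ * (D₂ * d₂) * (D₃ * d₃) * (D₄ * d₄))
  arrange″ = solve 9 (λ P D₁ d₁ D₂ d₂ D₃ d₃ D₄ d₄ →
    D₁ :* D₂ :* D₃ :* D₄ :* (P :* (d₁ :* d₂ :* d₃ :* d₄))
    := P :* (D₁ :* d₁ :* (D₂ :* d₂) :* (D₃ :* d₃) :* (D₄ :* d₄))) refl

  -- The five factors on the left are `5x + 3, …, 5x + 7`, that is `5^5` times the four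
  -- fifths-shifts and `x + 1`. Likewise `poch e 4` is `4^4` times `x + 3/4`, `x + 1`, `x + 5/4`,
  -- `x + 3/2`. Here `x + 1` cancels, and `ratio` is `4^4 / 5^5`.
  factors : ∀ x {x₁ x₂ x₃ x₄} →
    x₁ ≡ fromℕ 1 + x → x₂ ≡ fromℕ 2 + x → x₃ ≡ fromℕ 3 + x → x₄ ≡ fromℕ 4 + x →
    let e = fromℕ 4 * x + fromℕ 3 in
    ratio * (+ 5 / 4 + x) * (+ 3 / 4 + x) * (+ 3 / 2 + x)
      * ((e + x) * (e + x₁) * (e + x₂) * (e + x₃) * (e + x₄))
    ≡ poch e 4 * ((+ 6 / 5 + x) * (+ 7 / 5 + x) * (+ 3 / 5 + x) * (+ 4 / 5 + x))
  factors x refl refl refl refl = solve 1 (λ x →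
    let e = con (fromℕ 4) :* x :+ con (fromℕ 3) in
    con ratio :* (con (+ 5 / 4) :+ x) :* (con (+ 3 / 4) :+ x) :* (con (+ 3 / 2) :+ x)
      :* ((e :+ x) :* (e :+ (con (fromℕ 1) :+ x)) :* (e :+ (con (fromℕ 2) :+ x))
          :* (e :+ (con (fromℕ 3) :+ x)) :* (e :+ (con (fromℕ 4) :+ x)))
    := con 1ℚ :* (e :+ con (fromℕ 0)) :* (e :+ con (fromℕ 1)) :* (e :+ con (fromℕ 2))
         :* (e :+ con (fromℕ 3))
       :* ((con (+ 6 / 5) :+ x) :* (con (+ 7 / 5) :+ x)
           :* (con (+ 3 / 5) :+ x) :* (con (+ 4 / 5) :+ x))) refl x

-- Comparing the specialised summation with the closed form.

closedForm-spec : ∀ n →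
  closedForm n * closedFormDenominator n
  ≡ ratio ^ n * (poch (+ 5 / 4) n * poch (+ 3 / 4) n * poch (+ 3 / 2) n ^ 2)
closedForm-spec n = trans
  (*-assoc (ratio ^ n) (p ÷ closedFormDenominator n) (closedFormDenominator n))
  (cong (ratio ^ n *_) (÷-*-cancel p (closedFormDenominator n)))
  where
  p = poch (+ 5 / 4) n * poch (+ 3 / 4) n * poch (+ 3 / 2) n ^ 2
  instance _ = pos⇒nonZero (closedFormDenominator n) {{closedFormDenominator-pos n}}

theorem6 : ∀ (n : ℕ) →
    (∀ k → n < k → term n k ≡ 0ℚ) × (∑[ k ≤ n ] term n k) ≡ closedForm n
theorem6 n = summand-vanishes n , (begin
  fullSum n           ≡⟨ *-identityˡ (fullSum n) ⟨
  1ℚ * fullSum n      ≡⟨ fraction-cross {fullSum n} {q′ = closedForm n}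
                           {{poch-pos (4n+3 n) n {{4n+3-pos n}}}} {{closedFormDenominator-pos n}}
                           (fullSum-closed n) (closedForm-spec n) 1ℚ 1ℚ cross ⟩
  1ℚ * closedForm n   ≡⟨ *-identityˡ (closedForm n) ⟩
  closedForm n        ∎)
  where
  reflect : ∀ y → - y - + 3 / 2 ≡ + 3 / 2 - (y + fromℕ 3)
  reflect = solve 1 (λ y →
    :- y :- con (+ 3 / 2) := con (+ 3 / 2) :- (y :+ con (fromℕ 3))) refl

  -- `c` has the exact shape it has in `term`, its relation to `e` being a separate equation; thus
  -- `summand` at `fromℕ n` is definitionally `term n`.
  open WellPoised (- (fromℕ 4 * fromℕ n) - + 3 / 2) (4n+3 n) (4n+3-pos n)
    (reflect (fromℕ 4 * fromℕ n))

  R = ratio ^ n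
  A = poch (+ 5 / 4) n
  B = poch (+ 3 / 4) n
  C = poch (+ 3 / 2) n
  E = poch (4n+3 n) n

  arrange : ∀ R A B C E → 1ℚ * C * (R * (A * B * C) * E) ≡ 1ℚ * (R * (A * B * (C * (C * 1ℚ)))) * E
  arrange = solve 5 (λ R A B C E →
    con 1ℚ :* C :* (R :* (A :* B :* C) :* E)
    := con 1ℚ :* (R :* (A :* B :* (C :* (C :* con 1ℚ)))) :* E) refl

  -- The closed form carries `(3/2)_n` squared and the sum carries it once, so the comparison is
  -- `poch-product` multiplied by `C`.
  cross : 1ℚ * C * closedFormDenominator n ≡ 1ℚ * (R * (A * B * C ^ 2)) * E
  cross = begin
    1ℚ * C * closedFormDenominator n                 ≡⟨ cong (1ℚ * C *_) (poch-product n) ⟨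
    1ℚ * C * (R * (A * B * C) * E)                   ≡⟨ arrange R A B C E ⟩
    1ℚ * (R * (A * B * (C * (C * 1ℚ)))) * E          ∎
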